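{- Let $s\ge 1$ and let $L$ be a fixed set of $s$ positive integers with $L\ne[s]=\{1,\ldots,s\}$. If $\mathcal{F}\subseteq 2^{[n]}$ is $L$-differencing, then, as $n\to\infty$, $$|\mathcal{F}|\le\left(\frac{s}{s+1}+o_{L}(1)\right)\binom{n}{s}.$$ That is, for every $\varepsilon>0$ there is $n_0=n_0(L,\varepsilon)$ such that for every $n\ge n_0$ every $L$-differencing family $\mathcal{F}\subseteq 2^{[n]}$ satisfies $|\mathcal{F}|\le\left(\frac{s}{s+1}+\varepsilon\right)\binom{n}{s}$.
   Context: For a positive integer $m$, $[m]=\{1,\ldots,m\}$. For a nonempty set $L$ of positive integers, a family $\mathcal{F}\subseteq 2^{[n]}$ of subsets of $[n]$ is called $L$-differencing if $|A\setminus B|\in L$ for every ordered pair of distinct members $A,B\in\mathcal{F}$. The term $o_L(1)$ denotes a quantity depending only on $L$ and $n$ that tends to $0$ as $n\to\infty$ with $L$ fixed. -}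

module Defs where

open import Data.Fin.Subset using (Subset; _─_; ∣_∣)
open import Data.Integer.Base using (+_)
open import Data.List.Base using (List; map; upTo)
open import Data.List.Membership.Propositional using (_∈_)
open import Data.Nat.Base using (ℕ; suc)
open import Data.Rational.Base using (ℚ; _/_)
open import Relation.Binary.PropositionalEquality using (_≢_)

-- Finite sets of numbers and finite families of subsets are given as lists;
-- `Unique` is required wherever the length of a list stands for a cardinality.
-- The ground set {1,…,n} is represented by `Fin n`.

-- {1,…,m}; `upTo m` lists 0,…,m-1.
[1⋯_] : ℕ → List ℕ
[1⋯ m ] = map suc (upTo m)

Differencing : ∀ {n} → List ℕ → List (Subset n) → Set
Differencing L F = ∀ {A B} → A ∈ F → B ∈ F → A ≢ B → ∣ A ─ B ∣ ∈ L

fromℕ : ℕ → ℚ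
fromℕ m = + m / 1

{-# OPTIONS --safe #-}

-- Let ℓ be the largest element of L.  Relative to a base set Z, replace each member A by A △ Z;
-- then |A \ Z| + |Z \ B| = |A \ B| + |(A △ Z) ∩ (B △ Z)|.  Starting from a member as the base,
-- either greedy branching (flip a point of a bounded hitting set in Z) splits F into boundedly
-- many (L \ {ℓ})-differencing families, or it finds a base Z with many members A whose A △ Z are
-- pairwise disjoint of size ℓ.  In the second case |A △ Z| ≤ ℓ for every A in F, all but two
-- (L \ {ℓ})-differencing subfamilies attain equality, and for each point x the members A with
-- x ∈ A △ Z are (L \ {ℓ})-differencing, so counting pairs (x, A) bounds ℓ|F|.  Either way ℓ|F| is
-- at most n + O(1) times the bound for L \ {ℓ}; hence |F| ≤ (n + O(1))^s / ∏ L, and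
-- ∏ L ≥ (s + 1)! / s unless L = [s].
module Submission where

open import Defs
open import Data.Bool.Base using (true; false; not; _xor_)
import Data.Bool.Properties as Bool
open import Data.Empty using (⊥-elim)
open import Data.Fin.Base using (Fin; zero; suc)
open import Data.Fin.Subset using (Subset; _∩_; _─_; _-_; ∣_∣; inside; outside; Empty; ⊥; _∈_; _∉_)
open import Data.Fin.Subset.Properties using (_∈?_; nonempty?; drop-there; x∈p∩q⁺; x∈p∩q⁻; x∈p∧x≢y⇒x∈p-y; x∈p⇒∣p-x∣<∣p∣; Empty-unique; ∣⊥∣≡0; ∩-idem; ∩-comm)
open import Data.Integer.Base as ℤ using (+[1+_]; +≤+; +<+)
import Data.Integer.Properties as ℤ
open import Data.List.Base using (List; []; _∷_; length; filter; map; concatMap; allFin; tabulate; upTo; downFrom)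
open import Data.List.Extrema.Nat using (max; xs≤max)
open import Data.List.Membership.Propositional as List using (find)
open import Data.List.Membership.Propositional.Properties using (∈-filter⁺; ∈-allFin; ∈-concatMap⁺)
open import Data.List.Properties using (length-++; length-map; length-tabulate; filter-accept; filter-reject; reverse-upTo)
open import Data.List.Relation.Binary.BagAndSetEquality using (_∼[_]_; set; ↭⇒∼bag; bag-=⇒)
open import Data.List.Relation.Binary.Permutation.Propositional using (_↭_; ↭⇒↭ₛ; ↭-sym; ↭-trans; ↭-reflexive)
open import Data.List.Relation.Binary.Permutation.Propositional.Properties as ↭ using (↭-length; All-resp-↭; Any-resp-↭; ↭-reverse)
import Data.List.Relation.Binary.Permutation.Setoid.Properties as ↭ₛ
open import Data.List.Relation.Binary.Sublist.Propositional using (_⊆_; []; _∷ʳ_; _∷_; ⊆-refl; ⊆-trans)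
open import Data.List.Relation.Binary.Sublist.Propositional.Properties using (filter-⊆; All-resp-⊆; Any-resp-⊆)
open import Data.List.Relation.Unary.All as All using (All; []; _∷_)
open import Data.List.Relation.Unary.All.Properties as All using (all-filter; filter⁺; ¬All⇒Any¬)
open import Data.List.Relation.Unary.AllPairs as AllPairs using (AllPairs; []; _∷_)
open import Data.List.Relation.Unary.Any as Any using (Any; here; there)
open import Data.List.Relation.Unary.Sorted.TotalOrder.Properties using (Sorted⇒AllPairs)
open import Data.List.Relation.Unary.Unique.Propositional using (Unique)
import Data.List.Sort as Sort
open import Data.Nat.Base
open import Data.Nat.Combinatorics using (_C_; _P_; nCk≡nPk/k!)
open import Data.Nat.Combinatorics.Base using (_P′_)
open import Data.Nat.Combinatorics.Specification using (k!∣nP′k; nPk≡n!/[n∸k]!; nP′k≡n!/[n∸k]!)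
open import Data.Nat.Coprimality using (Coprime)
open import Data.Nat.DivMod using (m/n*n≡m)
open import Data.Nat.ListAction using (product)
open import Data.Nat.Properties
open import Algebra.Properties.CommutativeSemigroup *-commutativeSemigroup using () renaming (x∙yz≈y∙xz to *-x∙yz≈y∙xz; xy∙z≈y∙xz to *-xy∙z≈y∙xz)
open import Algebra.Properties.CommutativeSemigroup +-commutativeSemigroup using () renaming (x∙yz≈y∙xz to +-x∙yz≈y∙xz)
open import Data.Nat.Tactic.RingSolver using (solve-∀)
open import Data.Product.Base using (∃-syntax; _×_; _,_; proj₁; proj₂)
open import Data.Rational.Base as ℚ using (ℚ; mkℚ; 0ℚ; *<*)
open import Data.Rational.Properties using (toℚᵘ-cancel-≤; toℚᵘ-homo-+; toℚᵘ-homo-*; toℚᵘ-fromℚᵘ)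
open import Data.Rational.Unnormalised.Base as ℚᵘ using (mkℚᵘ; *≤*)
import Data.Rational.Unnormalised.Properties as ℚᵘ
open import Data.Sum.Base using (_⊎_; inj₁; inj₂; map₁)
open import Data.Vec.Base using ([]; _∷_; here; there; zipWith; updateAt)
open import Data.Vec.Properties using (≡-dec)
open import Function.Base using (_∘_; id; _on_)
open import Level using (Level)
open import Relation.Binary.Core using (Rel; REL)
import Relation.Binary.Construct.Flip.EqAndOrd as Flip
import Relation.Binary.Definitions as B
open import Relation.Binary.PropositionalEquality
open import Relation.Nullary using (¬_; yes; no; contradiction; does)
open import Relation.Unary using (Pred; Decidable)
open import Relation.Unary.Properties using (∁?)

private
  variable
    a b p r : Level
    X : Set a
    Y : Set b
    n : ℕ

-- Counting in lists: double counting, splitting and covering.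

AllPairs-resp-⊆ : {R : Rel X r} {xs ys : List X} → xs ⊆ ys → AllPairs R ys → AllPairs R xs
AllPairs-resp-⊆ []         []         = []
AllPairs-resp-⊆ (_ ∷ʳ s)   (_  ∷ prs) = AllPairs-resp-⊆ s prs
AllPairs-resp-⊆ (refl ∷ s) (rs ∷ prs) = All-resp-⊆ s rs ∷ AllPairs-resp-⊆ s prs

length-filter-∁ : {P : Pred X p} (P? : Decidable P) (xs : List X) →
                  length xs ≡ length (filter P? xs) + length (filter (∁? P?) xs)
length-filter-∁ P? []       = refl
length-filter-∁ P? (x ∷ xs) with does (P? x)
... | true  = cong suc (length-filter-∁ P? xs)
... | false = trans (cong suc (length-filter-∁ P? xs)) (sym (+-suc _ _))

module _ {R : REL X Y r} (R? : B.Decidable R) where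

  private
    row : X → List Y → List Y
    row x = filter (R? x)

    column : Y → List X → List X
    column y = filter (λ x → R? x y)

  incidences : List X → List Y → ℕ
  incidences []       ys = 0
  incidences (x ∷ xs) ys = length (row x ys) + incidences xs ys

  incidences-∷ : ∀ xs y ys → incidences xs (y ∷ ys) ≡ length (column y xs) + incidences xs ys
  incidences-∷ []       y ys = refl
  incidences-∷ (x ∷ xs) y ys rewrite incidences-∷ xs y ys with does (R? x y)
  ... | true  = cong suc (+-x∙yz≈y∙xz (length (row x ys)) (length (column y xs)) (incidences xs ys))
  ... | false = +-x∙yz≈y∙xz (length (row x ys)) (length (column y xs)) (incidences xs ys)

  -- The related pairs are counted once by columns and once by rows. The weight `w` stays a factor
  -- because rows are bounded only after multiplication by it; this avoids division.
  double-count : ∀ {k w m} xs ys → All (λ y → k ≤ length (column y xs)) ys →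
                 All (λ x → w * length (row x ys) ≤ m) xs →
                 k * (w * length ys) ≤ length xs * m
  double-count {k} {w} {m} xs ys ks ms = begin
    k * (w * length ys)     ≡⟨ lemma k w (length ys) ⟩
    w * (length ys * k)     ≤⟨ *-monoʳ-≤ w (columns ys ks) ⟩
    w * incidences xs ys    ≤⟨ rows xs ms ⟩
    length xs * m           ∎
    where
    open ≤-Reasoning
    lemma : ∀ i j k → i * (j * k) ≡ j * (k * i)
    lemma = solve-∀
    columns : ∀ ys → All (λ y → k ≤ length (column y xs)) ys → length ys * k ≤ incidences xs ys
    columns []       []       = z≤n
    columns (y ∷ ys) (k≤ ∷ ks) rewrite incidences-∷ xs y ys = +-mono-≤ k≤ (columns ys ks)
    rows : ∀ xs → All (λ x → w * length (row x ys) ≤ m) xs → w * incidences xs ys ≤ length xs * m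
    rows []       []        = ≤-reflexive (*-zeroʳ w)
    rows (x ∷ xs) (≤m ∷ ms) rewrite *-distribˡ-+ w (length (row x ys)) (incidences xs ys) =
      +-mono-≤ ≤m (rows xs ms)

-- `E` is an escape: in `branch` it is a bound on the whole family, so a single piece that reaches
-- it settles the matter.
+-mono-≤⊎ : ∀ {i j k l} {E : Set p} → i ≤ j ⊎ E → k ≤ l ⊎ E → i + k ≤ j + l ⊎ E
+-mono-≤⊎ (inj₁ i≤j) (inj₁ k≤l) = inj₁ (+-mono-≤ i≤j k≤l)
+-mono-≤⊎ (inj₁ _)   (inj₂ e)   = inj₂ e
+-mono-≤⊎ (inj₂ e)   _          = inj₂ e

*-length-filter-∁ : {P : Pred X p} (P? : Decidable P) (w : ℕ) (xs : List X) →
                    w * length xs ≡ w * length (filter P? xs) + w * length (filter (∁? P?) xs)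
*-length-filter-∁ P? w xs =
  trans (cong (w *_) (length-filter-∁ P? xs)) (*-distribˡ-+ w (length (filter P? xs)) _)

length-split : {P : Pred X p} (P? : Decidable P) {E : Set r} (w : ℕ) {i j : ℕ} (xs : List X) →
               w * length (filter P? xs) ≤ i ⊎ E → w * length (filter (∁? P?) xs) ≤ j ⊎ E →
               w * length xs ≤ i + j ⊎ E
length-split P? w xs l r rewrite *-length-filter-∁ P? w xs = +-mono-≤⊎ l r

-- Each entry of `ys` is charged to the first `x` related to it, so `ys` is cut into one sublist for
-- each `x`, and `small` applies to each of them.
length-cover : {R : REL X Y r} (R? : B.Decidable R) {E : Set p} (w : ℕ) {m : ℕ} (xs : List X) (ys : List Y) →
               (∀ x {zs} → zs ⊆ ys → All (R x) zs → w * length zs ≤ m ⊎ E) →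
               All (λ y → Any (λ x → R x y) xs) ys →
               w * length ys ≤ length xs * m ⊎ E
length-cover R? w []       []      small []       = inj₁ (≤-reflexive (*-zeroʳ w))
length-cover R? w []       (_ ∷ _) small (() ∷ _)
length-cover {R = R} R? w (x ∷ xs) ys small covered =
  length-split (R? x) w ys
    (small x (filter-⊆ (R? x) ys) (all-filter (R? x) ys))
    (length-cover R? w xs _ (λ x′ zs⊆ → small x′ (⊆-trans zs⊆ (filter-⊆ (∁? (R? x)) ys)))
      (All.zipWith uncovered (all-filter (∁? (R? x)) ys , filter⁺ (∁? (R? x)) covered)))
  where
  uncovered : ∀ {y} → ¬ R x y × Any (λ x → R x y) (x ∷ xs) → Any (λ x → R x y) xs
  uncovered (¬r , here r)  = contradiction r ¬r
  uncovered (¬r , there i) = i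

-- Points of a subset; disjoint selections and hitting sets.

elements : Subset n → List (Fin n)
elements p = filter (_∈? p) (allFin _)

length-elements : (p : Subset n) → length (elements p) ≡ ∣ p ∣
length-elements p = pullback p p id id id
  where
  -- Recursion on `p` shifts the tabulated function while the filter still tests the original set;
  -- hence the general form, where `p` is the preimage of `q` under `f`.
  pullback : ∀ {m n} (q : Subset m) (p : Subset n) (f : Fin n → Fin m) →
             (∀ {i} → i ∈ p → f i ∈ q) → (∀ {i} → f i ∈ q → i ∈ p) →
             length (filter (_∈? q) (tabulate f)) ≡ ∣ p ∣
  pullback q []            f to from = refl
  pullback q (inside ∷ p)  f to from
    rewrite filter-accept (_∈? q) {x = f zero} {xs = tabulate (f ∘ suc)} (to here) =
    cong suc (pullback q p (f ∘ suc) (to ∘ there) (drop-there ∘ from))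
  pullback q (outside ∷ p) f to from
    rewrite filter-reject (_∈? q) {x = f zero} {xs = tabulate (f ∘ suc)} (λ f0∈q → contradiction (from f0∈q) λ ()) =
    pullback q p (f ∘ suc) (to ∘ there) (drop-there ∘ from)

∈-elements : {x : Fin n} {p : Subset n} → x ∈ p → x List.∈ elements p
∈-elements {p = p} x∈p = ∈-filter⁺ (_∈? p) (∈-allFin _) x∈p

Disjoint : Rel (Subset n) _
Disjoint p q = Empty (p ∩ q)

module _ (f : X → Subset n) where

  -- A disjoint selection is enlarged one set at a time. If no set avoids all the chosen ones, their
  -- union meets every set, and it has at most `k` points per chosen set.
  greedy : ∀ {k} q (xs : List X) → All (λ x → ∣ f x ∣ ≤ k) xs →
           (∃[ ys ] length ys ≡ q × All (List._∈ xs) ys × AllPairs (Disjoint on f) ys) ⊎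
           (∃[ T ] length T ≤ q * k × All (λ x → Any (_∈ f x) T) xs)
  greedy zero    xs ∣f∣≤k = inj₁ ([] , refl , [] , [])
  greedy (suc q) xs ∣f∣≤k with greedy q xs ∣f∣≤k
  ... | inj₂ (T , ∣T∣≤ , hit) = inj₂ (T , ≤-trans ∣T∣≤ (m≤n+m _ _) , hit)
  ... | inj₁ (ys , refl , ys∈ , disj) with All.all? (λ x → Any.any? (_∈? f x) T) xs
    where T = concatMap (elements ∘ f) ys
  ...   | yes hit = inj₂ (concatMap (elements ∘ f) ys , ∣T∣≤ ys ys∈ , hit)
    where
    ∣T∣≤ : ∀ ys → All (List._∈ xs) ys → length (concatMap (elements ∘ f) ys) ≤ suc (length ys) * _
    ∣T∣≤ ys ys∈ = ≤-trans (go ys ys∈) (m≤n+m _ _)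
      where
      go : ∀ ys → All (List._∈ xs) ys → length (concatMap (elements ∘ f) ys) ≤ length ys * _
      go []       []         = z≤n
      go (y ∷ ys) (y∈ ∷ ys∈)
        rewrite length-++ (elements (f y)) {concatMap (elements ∘ f) ys} | length-elements (f y) =
        +-mono-≤ (All.lookup ∣f∣≤k y∈) (go ys ys∈)
  ...   | no ¬hit with find (¬All⇒Any¬ (λ x → Any.any? (_∈? f x) T) xs ¬hit)
    where T = concatMap (elements ∘ f) ys
  ...     | x , x∈ , ¬x = inj₁ (x ∷ ys , refl , x∈ ∷ ys∈ , All.tabulate apart ∷ disj)
    where
    apart : ∀ {y} → y List.∈ ys → Disjoint (f x) (f y)
    apart y∈ (i , i∈) = let i∈fx , i∈fy = x∈p∩q⁻ (f x) _ i∈ in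
      ¬x (Any.map (λ { refl → i∈fx }) (∈-concatMap⁺ (elements ∘ f) (Any.map (λ { refl → ∈-elements i∈fy }) y∈)))

  -- A point of `p` lies in at most one of the disjoint sets, so fewer points than sets leave some
  -- set untouched. The recursion discards the first set together with one point of `p` in it.
  disjoint-member : ∀ {p} xs → AllPairs (Disjoint on f) xs → ∣ p ∣ < length xs → Any (λ x → Disjoint (f x) p) xs
  disjoint-member {p} (x ∷ xs) (x# ∷ xs#) (s≤s ∣p∣≤) with nonempty? (f x ∩ p)
  ... | no empty      = here empty
  ... | yes (i , i∈) = there (rest (proj₁ i∈both) x# (disjoint-member xs xs# (≤-trans (x∈p⇒∣p-x∣<∣p∣ (proj₂ i∈both)) ∣p∣≤)))
    where
    i∈both = x∈p∩q⁻ (f x) p i∈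
    -- The removed `i` lies in `f x`, hence in no later set, so a later set that avoids `p - i`
    -- avoids `p`.
    rest : ∀ {xs} → i ∈ f x → All (Disjoint (f x) ∘ f) xs → Any (λ y → Disjoint (f y) (p - i)) xs →
           Any (λ y → Disjoint (f y) p) xs
    rest i∈fx (_  ∷ x#) (there any)    = there (rest i∈fx x# any)
    rest i∈fx (x#y ∷ _) (here {y} y#p-i) = here λ (j , j∈) → let j∈fy , j∈p = x∈p∩q⁻ (f y) p j∈ in
      y#p-i (j , x∈p∩q⁺ (j∈fy , x∈p∧x≢y⇒x∈p-y j∈p λ { refl → x#y (i , x∈p∩q⁺ (i∈fx , j∈fy)) }))

-- Differences measured through a base set.

infixl 5 _△_
_△_ : Subset n → Subset n → Subset n
_△_ = zipWith _xor_

-- Checked point by point. The last term is the defect of the triangle inequality through `Z`: it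
-- vanishes when `A △ Z` and `B △ Z` are disjoint and is positive when they share a point.
∣─∣-via : (A Z B : Subset n) → ∣ A ─ Z ∣ + ∣ Z ─ B ∣ ≡ ∣ A ─ B ∣ + ∣ (A △ Z) ∩ (B △ Z) ∣
∣─∣-via []            []            []            = refl
∣─∣-via (inside ∷ A)  (inside ∷ Z)  (inside ∷ B)  = ∣─∣-via A Z B
∣─∣-via (inside ∷ A)  (inside ∷ Z)  (outside ∷ B) = trans (+-suc _ _) (cong suc (∣─∣-via A Z B))
∣─∣-via (inside ∷ A)  (outside ∷ Z) (inside ∷ B)  = trans (cong suc (∣─∣-via A Z B)) (sym (+-suc _ _))
∣─∣-via (inside ∷ A)  (outside ∷ Z) (outside ∷ B) = cong suc (∣─∣-via A Z B)
∣─∣-via (outside ∷ A) (inside ∷ Z)  (inside ∷ B)  = ∣─∣-via A Z B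
∣─∣-via (outside ∷ A) (inside ∷ Z)  (outside ∷ B) = trans (+-suc _ _) (trans (cong suc (∣─∣-via A Z B)) (sym (+-suc _ _)))
∣─∣-via (outside ∷ A) (outside ∷ Z) (inside ∷ B)  = ∣─∣-via A Z B
∣─∣-via (outside ∷ A) (outside ∷ Z) (outside ∷ B) = ∣─∣-via A Z B

∣p─p∣≡0 : (p : Subset n) → ∣ p ─ p ∣ ≡ 0
∣p─p∣≡0 []            = refl
∣p─p∣≡0 (inside ∷ p)  = ∣p─p∣≡0 p
∣p─p∣≡0 (outside ∷ p) = ∣p─p∣≡0 p

∣△∣ : (A Z : Subset n) → ∣ A △ Z ∣ ≡ ∣ A ─ Z ∣ + ∣ Z ─ A ∣
∣△∣ A Z = sym (trans (∣─∣-via A Z A) (cong₂ (λ i q → i + ∣ q ∣) (∣p─p∣≡0 A) (∩-idem (A △ Z))))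

∣─∣-triangle : (A Z B : Subset n) → ∣ A ─ B ∣ ≤ ∣ A ─ Z ∣ + ∣ Z ─ B ∣
∣─∣-triangle A Z B = ≤-trans (m≤m+n _ _) (≤-reflexive (sym (∣─∣-via A Z B)))

∣─∣-disjoint : (A Z B : Subset n) → Disjoint (A △ Z) (B △ Z) → ∣ A ─ B ∣ ≡ ∣ A ─ Z ∣ + ∣ Z ─ B ∣
∣─∣-disjoint {n} A Z B A#B = sym (begin
  ∣ A ─ Z ∣ + ∣ Z ─ B ∣                 ≡⟨ ∣─∣-via A Z B ⟩
  ∣ A ─ B ∣ + ∣ (A △ Z) ∩ (B △ Z) ∣     ≡⟨ cong (λ q → ∣ A ─ B ∣ + ∣ q ∣) (Empty-unique A#B) ⟩
  ∣ A ─ B ∣ + ∣ ⊥ {n} ∣                 ≡⟨ cong (∣ A ─ B ∣ +_) (∣⊥∣≡0 n) ⟩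
  ∣ A ─ B ∣ + 0                         ≡⟨ +-identityʳ _ ⟩
  ∣ A ─ B ∣                             ∎)
  where open ≡-Reasoning

∣─∣-overlap : ∀ {x} (A Z B : Subset n) → x ∈ A △ Z → x ∈ B △ Z → ∣ A ─ B ∣ < ∣ A ─ Z ∣ + ∣ Z ─ B ∣
∣─∣-overlap A Z B x∈A x∈B = subst (∣ A ─ B ∣ <_) (sym (∣─∣-via A Z B))
  (m<m+n _ (≤-trans (s≤s z≤n) (x∈p⇒∣p-x∣<∣p∣ (x∈p∩q⁺ (x∈A , x∈B)))))

flip : Fin n → Subset n → Subset n
flip x Z = updateAt Z x not

-- The point is missing from `A`, so deleting it moves the base one step towards `A`.
flip-inside : ∀ {x} (A Z : Subset n) → x ∈ Z → x ∈ A △ Z →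
              ∣ A ─ flip x Z ∣ ≡ ∣ A ─ Z ∣ × suc ∣ flip x Z ─ A ∣ ≡ ∣ Z ─ A ∣
flip-inside (outside ∷ A) (inside ∷ Z) here here = refl , refl
flip-inside (s ∷ A) (t ∷ Z) (there x∈Z) (there x∈△) with flip-inside A Z x∈Z x∈△
flip-inside (inside ∷ A)  (inside ∷ Z)  _ _ | p , q = p , q
flip-inside (outside ∷ A) (inside ∷ Z)  _ _ | p , q = p , cong suc q
flip-inside (inside ∷ A)  (outside ∷ Z) _ _ | p , q = cong suc p , q
flip-inside (outside ∷ A) (outside ∷ Z) _ _ | p , q = p , q

-- Dually, the point lies in `A`, so the step towards `A` adds it to the base and lowers the other
-- count.
flip-outside : ∀ {x} (A Z : Subset n) → x ∉ Z → x ∈ A △ Z →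
               suc ∣ A ─ flip x Z ∣ ≡ ∣ A ─ Z ∣ × ∣ flip x Z ─ A ∣ ≡ ∣ Z ─ A ∣
flip-outside {x = zero} (inside ∷ A)  (outside ∷ Z) _   _  = refl , refl
flip-outside {x = zero} (outside ∷ A) (outside ∷ Z) _   ()
flip-outside {x = zero} (s ∷ A)       (inside ∷ Z)  x∉Z _  = contradiction here x∉Z
flip-outside {x = suc _} (s ∷ A) (t ∷ Z) x∉Z (there x∈△) with flip-outside A Z (x∉Z ∘ there) x∈△
flip-outside (inside ∷ A)  (inside ∷ Z)  _ (there _) | p , q = p , q
flip-outside (outside ∷ A) (inside ∷ Z)  _ (there _) | p , q = p , cong suc q
flip-outside (inside ∷ A)  (outside ∷ Z) _ (there _) | p , q = cong suc p , q
flip-outside (outside ∷ A) (outside ∷ Z) _ (there _) | p , q = p , q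

-- Eliminating the largest difference: branching and sunflowers.

private
  distrib : ∀ ℓ m k → ℓ * (m + (m + k)) ≡ ℓ * k + (ℓ + ℓ) * m
  distrib = solve-∀

-- A member A has |A △ Z| ≤ 4ℓ by going through one petal, hence misses one of 4ℓ + 1 disjoint petals;
-- the last one makes the existence of two petals hold by computation.
petals : ℕ → ℕ
petals ℓ = 2 + (ℓ + ℓ + (ℓ + ℓ))

-- One level of branching has two pieces lying strictly below a budget, and one piece for each point
-- of a hitting set for sets of size at most `suc k`.
branches : ℕ → ℕ → ℕ
branches ℓ zero    = 1
branches ℓ (suc k) = (2 + petals ℓ * suc k) * branches ℓ k

branches>0 : ∀ ℓ k → 0 < branches ℓ k
branches>0 ℓ zero    = ≤-refl
branches>0 ℓ (suc k) = ≤-trans (branches>0 ℓ k) (m≤n*m _ (2 + petals ℓ * suc k))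

-- The first summand pays for the sunflower outcome, the second for branching from total budget
-- `ℓ + ℓ`; the sum covers either.
slack : ℕ → ℕ
slack ℓ = (ℓ + ℓ) + ℓ * branches ℓ (ℓ + ℓ)

-- `small` is the induction hypothesis, for subfamilies in which the difference `ℓ` does not occur.
-- In the application `w` is the product of the elements of L below `ℓ`.
module _ {n ℓ w m : ℕ} {F : List (Subset n)} (0<ℓ : 0 < ℓ)
         (≤ℓ : ∀ {A B} → A List.∈ F → B List.∈ F → ∣ A ─ B ∣ ≤ ℓ)
         (small : ∀ {H} → H ⊆ F → (∀ {A B} → A List.∈ H → B List.∈ H → ∣ A ─ B ∣ < ℓ) →
                  w * length H ≤ m)
         where

  private
    -- The two directions have separate budgets because a flip of the base lowers exactly one of
    -- them.
    Within Exact : Subset n → ℕ → ℕ → Subset n → Set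
    Within Z a b A = ∣ A ─ Z ∣ ≤ b × ∣ Z ─ A ∣ ≤ a
    Exact  Z a b A = ∣ A ─ Z ∣ ≡ b × ∣ Z ─ A ∣ ≡ a

  small-via : ∀ {H} Z {a b} → H ⊆ F → All (Within Z a b) H → b + a < ℓ → w * length H ≤ m
  small-via Z H⊆F within b+a<ℓ = small H⊆F λ {A} {B} A∈ B∈ →
    ≤-<-trans (∣─∣-triangle A Z B)
      (≤-<-trans (+-mono-≤ (proj₁ (All.lookup within A∈)) (proj₂ (All.lookup within B∈))) b+a<ℓ)

  -- A common point `x` makes the triangle inequality through `Z` strict, which keeps all
  -- differences below `b + a`.
  small-through : ∀ {H} Z {a b x} → H ⊆ F → All (Exact Z a b) H → a + b ≡ ℓ →
                  All (λ A → x ∈ A △ Z) H → w * length H ≤ m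
  small-through Z {a} {b} H⊆F exact refl through = small H⊆F λ {A} {B} A∈ B∈ →
    ≤-trans (∣─∣-overlap A Z B (All.lookup through A∈) (All.lookup through B∈))
      (≤-reflexive (trans (cong₂ _+_ (proj₁ (All.lookup exact A∈)) (proj₂ (All.lookup exact B∈))) (+-comm b a)))

  Sunflower-bound : Set
  Sunflower-bound = ℓ * (w * length F) ≤ (n + (ℓ + ℓ)) * m

  module _ {Z : Subset n} {a b : ℕ} where

    refine : ∀ {H} → All (Within Z a b) H →
             All (Exact Z a b) (filter (∁? (λ A → ∣ Z ─ A ∣ <? a)) (filter (∁? (λ A → ∣ A ─ Z ∣ <? b)) H))
    refine {H} within = All.zipWith (λ { ((≤b , ≤a) , ≮b , ≮a) → ≤-antisym ≤b (≮⇒≥ ≮b) , ≤-antisym ≤a (≮⇒≥ ≮a) })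
      ( filter⁺ a? (filter⁺ b? within)
      , All.zip (filter⁺ a? (all-filter b? H) , all-filter a? (filter b? H)) )
      where
      a? = ∁? (λ A → ∣ Z ─ A ∣ <? a)
      b? = ∁? (λ A → ∣ A ─ Z ∣ <? b)

    -- Count pairs of a point `x` and a member `A` with `x ∈ A △ Z`: every `A` contributes exactly
    -- `ℓ` points, and `small-through` bounds the members at each point.
    exact-bound : a + b ≡ ℓ → ∀ {H} → H ⊆ F → All (Exact Z a b) H → ℓ * (w * length H) ≤ n * m
    exact-bound a+b≡ℓ {H} H⊆F exact = subst (λ k → ℓ * (w * length H) ≤ k * m) (length-tabulate {n = n} id)
      (double-count (λ x A → x ∈? A △ Z) {w = w} (allFin n) H
        (All.map (λ {A} (eb , ea) → ≤-reflexive (sym (trans (length-elements (A △ Z))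
          (trans (∣△∣ A Z) (trans (cong₂ _+_ eb ea) (trans (+-comm b a) a+b≡ℓ)))))) exact)
        (All.universal (λ x → small-through Z (⊆-trans (filter-⊆ _ H) H⊆F) (filter⁺ _ exact) a+b≡ℓ
          (all-filter (λ A → x ∈? A △ Z) H)) (allFin n)))

    -- Members strictly below one of the budgets have mutual differences below `b + a`, so they form
    -- two small families, which cost `(ℓ + ℓ) * m`. The rest is exact.
    within-bound : a + b ≡ ℓ → All (Within Z a b) F → Sunflower-bound
    within-bound a+b≡ℓ within = begin
      ℓ * (w * length F)
        ≡⟨ cong (ℓ *_) (trans (*-length-filter-∁ b? w F) (cong (w * length (filter b? F) +_) (*-length-filter-∁ a? w F′))) ⟩
      ℓ * (w * length (filter b? F) + (w * length (filter a? F′) + w * length (filter (∁? a?) F′)))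
        ≤⟨ *-monoʳ-≤ ℓ (+-mono-≤ below-b (+-monoˡ-≤ _ below-a)) ⟩
      ℓ * (m + (m + w * length (filter (∁? a?) F′)))
        ≡⟨ distrib ℓ m (w * length (filter (∁? a?) F′)) ⟩
      ℓ * (w * length (filter (∁? a?) F′)) + (ℓ + ℓ) * m
        ≤⟨ +-monoˡ-≤ _ (exact-bound a+b≡ℓ (⊆-trans (filter-⊆ _ F′) F′⊆F) (refine within)) ⟩
      n * m + (ℓ + ℓ) * m
        ≡⟨ *-distribʳ-+ m n (ℓ + ℓ) ⟨
      (n + (ℓ + ℓ)) * m
        ∎
      where
      open ≤-Reasoning
      a? = λ A → ∣ Z ─ A ∣ <? a
      b? = λ A → ∣ A ─ Z ∣ <? b
      F′ = filter (∁? b?) F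
      F′⊆F : F′ ⊆ F
      F′⊆F = filter-⊆ _ F
      below-b : w * length (filter b? F) ≤ m
      below-b = small (filter-⊆ _ F) λ {A} {B} A∈ B∈ → ≤-<-trans (∣─∣-triangle A Z B)
        (<-≤-trans (+-mono-<-≤ (All.lookup (all-filter b? F) A∈) (proj₂ (All.lookup (filter⁺ b? within) B∈)))
          (≤-reflexive (trans (+-comm b a) a+b≡ℓ)))
      below-a : w * length (filter a? F′) ≤ m
      below-a = small (⊆-trans (filter-⊆ _ F′) F′⊆F) λ {A} {B} A∈ B∈ → ≤-<-trans (∣─∣-triangle A Z B)
        (<-≤-trans (+-mono-≤-< (proj₁ (All.lookup (filter⁺ a? (filter⁺ (∁? b?) within)) A∈)) (All.lookup (all-filter a? F′) B∈))
          (≤-reflexive (trans (+-comm b a) a+b≡ℓ)))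

    -- For each member `A` some petal `B △ Z` misses `A △ Z`. The triangle inequality through `Z` is
    -- then an equality in both directions; its left side is at most `ℓ`, and cancelling the known
    -- distance between `B` and `Z` leaves the budget for `A`.
    sunflower : a + b ≡ ℓ → ∀ S → length S ≡ petals ℓ → All (List._∈ F) S →
                AllPairs (Disjoint on (_△ Z)) S → All (Exact Z a b) S → Sunflower-bound
    sunflower refl S@(B₀ ∷ _) ∣S∣ S∈ disj exact@((eb₀ , ea₀) ∷ _) = within-bound refl (All.tabulate near)
      where
      near : ∀ {A} → A List.∈ F → Within Z a b A
      near {A} A∈ with find (disjoint-member (_△ Z) {p = A △ Z} S disj (subst (∣ A △ Z ∣ <_) (sym ∣S∣) (s≤s (m≤n⇒m≤1+n ∣A△Z∣≤))))
        where
        ∣A△Z∣≤ : ∣ A △ Z ∣ ≤ ℓ + ℓ + (ℓ + ℓ)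
        ∣A△Z∣≤ = begin
          ∣ A △ Z ∣                                                ≡⟨ ∣△∣ A Z ⟩
          ∣ A ─ Z ∣ + ∣ Z ─ A ∣                                    ≤⟨ +-mono-≤ (∣─∣-triangle A B₀ Z) (∣─∣-triangle Z B₀ A) ⟩
          ∣ A ─ B₀ ∣ + ∣ B₀ ─ Z ∣ + (∣ Z ─ B₀ ∣ + ∣ B₀ ─ A ∣)
            ≤⟨ +-mono-≤ (+-mono-≤ (≤ℓ A∈ (All.head S∈)) (≤-trans (≤-reflexive eb₀) (m≤n+m b a)))
                        (+-mono-≤ (≤-trans (≤-reflexive ea₀) (m≤m+n a b)) (≤ℓ (All.head S∈) A∈)) ⟩
          ℓ + ℓ + (ℓ + ℓ)                                          ∎
          where open ≤-Reasoning
      ... | B , B∈S , B#A = +-cancelʳ-≤ a _ _ (begin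
          ∣ A ─ Z ∣ + a          ≡⟨ cong (∣ A ─ Z ∣ +_) ea ⟨
          ∣ A ─ Z ∣ + ∣ Z ─ B ∣  ≡⟨ ∣─∣-disjoint A Z B (λ (i , i∈) → B#A (i , subst (i ∈_) (∩-comm _ _) i∈)) ⟨
          ∣ A ─ B ∣              ≤⟨ ≤ℓ A∈ B∈ ⟩
          a + b                  ≡⟨ +-comm a b ⟩
          b + a                  ∎)
        , +-cancelˡ-≤ b _ _ (begin
          b + ∣ Z ─ A ∣          ≡⟨ cong (_+ ∣ Z ─ A ∣) eb ⟨
          ∣ B ─ Z ∣ + ∣ Z ─ A ∣  ≡⟨ ∣─∣-disjoint B Z A B#A ⟨
          ∣ B ─ A ∣              ≤⟨ ≤ℓ B∈ A∈ ⟩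
          a + b                  ≡⟨ +-comm a b ⟩
          b + a                  ∎)
        where
        open ≤-Reasoning
        B∈ = All.lookup S∈ B∈S
        eb = proj₁ (All.lookup exact B∈S)
        ea = proj₂ (All.lookup exact B∈S)

  -- Induction on the total budget `k`. Below `ℓ` the family is small. Otherwise members off the
  -- exact budgets recurse with the same base, and the exact ones either have a bounded hitting set,
  -- each point of which gives a flip that saves one unit, or contain a sunflower.
  branch : ∀ k Z {a b H} → a + b ≡ k → H ⊆ F → All (Within Z a b) H →
           w * length H ≤ branches ℓ k * m ⊎ Sunflower-bound
  branch k Z {a} {b} a+b≡ H⊆F within with k <? ℓ
  ... | yes a+b<ℓ = inj₁ (≤-trans (small-via Z H⊆F within (subst (_< ℓ) (trans (sym a+b≡) (+-comm a b)) a+b<ℓ))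
                             (m≤n*m m (branches ℓ k) {{>-nonZero (branches>0 ℓ k)}}))
  branch zero    Z eq _ _ | no ≮ℓ = contradiction 0<ℓ ≮ℓ
  branch (suc k) Z {a} {b} {H} a+b≡ H⊆F within | no ≮ℓ =
    map₁ (subst (w * length H ≤_) (sym (*-assoc (2 + petals ℓ * suc k) (branches ℓ k) m)))
    (length-split b? w H (shrink-b b Z a+b≡ (⊆-trans (filter-⊆ b? H) H⊆F)
        (All.zipWith (λ ((_ , ≤a) , <b) → <b , ≤a) (filter⁺ b? within , all-filter b? H)))
      (length-split a? w H′ (shrink-a a Z a+b≡ (⊆-trans (filter-⊆ a? H′) H′⊆F)
        (All.zipWith (λ ((≤b , _) , <a) → ≤b , <a) (filter⁺ a? (filter⁺ (∁? b?) within) , all-filter a? H′)))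
        (exact-case (greedy (_△ Z) (petals ℓ) G (All.map ∣△∣≤ exact)))))
    where
    a? = λ A → ∣ Z ─ A ∣ <? a
    b? = λ A → ∣ A ─ Z ∣ <? b
    H′ = filter (∁? b?) H
    H′⊆F : H′ ⊆ F
    H′⊆F = ⊆-trans (filter-⊆ _ H) H⊆F
    G = filter (∁? a?) H′
    G⊆F : G ⊆ F
    G⊆F = ⊆-trans (filter-⊆ _ H′) H′⊆F
    exact : All (Exact Z a b) G
    exact = refine within

    -- The base is arbitrary because this serves both the inexact members and, in `through`, the
    -- flipped bases. A zero budget admits no member strictly below it.
    shrink-b : ∀ {a} b Z {G} → a + b ≡ suc k → G ⊆ F → All (λ A → ∣ A ─ Z ∣ < b × ∣ Z ─ A ∣ ≤ a) G →
               w * length G ≤ branches ℓ k * m ⊎ Sunflower-bound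
    shrink-b zero    Z eq G⊆F []              = inj₁ (≤-trans (≤-reflexive (*-zeroʳ w)) z≤n)
    shrink-b zero    Z eq G⊆F ((() , _) ∷ _)
    shrink-b {a} (suc b) Z eq G⊆F within =
      branch k Z (suc-injective (trans (sym (+-suc a b)) eq)) G⊆F (All.map (λ (<b , ≤a) → s≤s⁻¹ <b , ≤a) within)

    shrink-a : ∀ a {b} Z {G} → a + b ≡ suc k → G ⊆ F → All (λ A → ∣ A ─ Z ∣ ≤ b × ∣ Z ─ A ∣ < a) G →
               w * length G ≤ branches ℓ k * m ⊎ Sunflower-bound
    shrink-a zero    Z eq G⊆F []              = inj₁ (≤-trans (≤-reflexive (*-zeroʳ w)) z≤n)
    shrink-a zero    Z eq G⊆F ((_ , ()) ∷ _)
    shrink-a (suc a) Z eq G⊆F within =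
      branch k Z (suc-injective eq) G⊆F (All.map (λ (≤b , <a) → ≤b , s≤s⁻¹ <a) within)

    ∣△∣≤ : ∀ {A} → Exact Z a b A → ∣ A △ Z ∣ ≤ suc k
    ∣△∣≤ {A} (eb , ea) = ≤-reflexive (trans (∣△∣ A Z) (trans (cong₂ _+_ eb ea) (trans (+-comm b a) a+b≡)))

    through : ∀ x {G′} → G′ ⊆ G → All (λ A → x ∈ A △ Z) G′ → w * length G′ ≤ branches ℓ k * m ⊎ Sunflower-bound
    through x G′⊆G x∈△ with x ∈? Z
    ... | yes x∈Z = shrink-a a (flip x Z) a+b≡ (⊆-trans G′⊆G G⊆F)
      (All.zipWith (λ {A} ((eb , ea) , x∈△) → let p , q = flip-inside A Z x∈Z x∈△ in
        ≤-reflexive (trans p eb) , ≤-reflexive (trans q ea)) (All-resp-⊆ G′⊆G exact , x∈△))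
    ... | no  x∉Z = shrink-b b (flip x Z) a+b≡ (⊆-trans G′⊆G G⊆F)
      (All.zipWith (λ {A} ((eb , ea) , x∈△) → let p , q = flip-outside A Z x∉Z x∈△ in
        ≤-reflexive (trans p eb) , ≤-reflexive (trans q ea)) (All-resp-⊆ G′⊆G exact , x∈△))

    exact-case : _ → w * length G ≤ petals ℓ * suc k * (branches ℓ k * m) ⊎ Sunflower-bound
    exact-case (inj₂ (T , ∣T∣≤ , hit)) =
      map₁ (λ le → ≤-trans le (*-monoˡ-≤ (branches ℓ k * m) ∣T∣≤))
        (length-cover (λ x A → x ∈? A △ Z) w T G through hit)
    -- Two disjoint petals realise the difference `b + a`, so it is at most `ℓ`; the failed test
    -- `k <? ℓ` gives the converse.
    exact-case (inj₁ (S , ∣S∣ , S∈G , disj)) = inj₂ (sunflower (≤-antisym (two-petals S ∣S∣ S∈G disj) (≮⇒≥ (≮ℓ ∘ subst (_< ℓ) a+b≡)))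
        S ∣S∣ (All.map (Any-resp-⊆ G⊆F) S∈G) disj (All.map (All.lookup exact) S∈G))
      where
      two-petals : ∀ S → length S ≡ petals ℓ → All (List._∈ G) S → AllPairs (Disjoint on (_△ Z)) S → a + b ≤ ℓ
      two-petals []           () _ _
      two-petals (_ ∷ [])     () _ _
      two-petals (B ∷ B′ ∷ _) _ (B∈ ∷ B′∈ ∷ _) ((B#B′ ∷ _) ∷ _) = begin
        a + b                    ≡⟨ +-comm a b ⟩
        b + a                    ≡⟨ cong₂ _+_ (proj₁ (All.lookup exact B∈)) (proj₂ (All.lookup exact B′∈)) ⟨
        ∣ B ─ Z ∣ + ∣ Z ─ B′ ∣   ≡⟨ ∣─∣-disjoint B Z B′ B#B′ ⟨
        ∣ B ─ B′ ∣               ≤⟨ ≤ℓ (Any-resp-⊆ G⊆F B∈) (Any-resp-⊆ G⊆F B′∈) ⟩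
        ℓ                        ∎
        where open ≤-Reasoning

-- Taking a member as the first base starts both budgets at `ℓ`.
reduction : ∀ {n ℓ w m} {F : List (Subset n)} → 0 < ℓ →
            (∀ {A B} → A List.∈ F → B List.∈ F → ∣ A ─ B ∣ ≤ ℓ) →
            (∀ {H} → H ⊆ F → (∀ {A B} → A List.∈ H → B List.∈ H → ∣ A ─ B ∣ < ℓ) → w * length H ≤ m) →
            ℓ * (w * length F) ≤ (n + slack ℓ) * m
reduction {ℓ = ℓ} {w} {F = []}    _ _ _ rewrite *-zeroʳ w | *-zeroʳ ℓ = z≤n
reduction {n} {ℓ} {w} {m} {F@(A₀ ∷ _)} 0<ℓ ≤ℓ small
  with branch {w = w} 0<ℓ ≤ℓ small (ℓ + ℓ) A₀ refl ⊆-refl (All.tabulate λ A∈ → ≤ℓ A∈ (here refl) , ≤ℓ (here refl) A∈)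
... | inj₂ bound = ≤-trans bound (*-monoˡ-≤ m (+-monoʳ-≤ n (m≤m+n (ℓ + ℓ) _)))
... | inj₁ bound = begin
  ℓ * (w * length F)                   ≤⟨ *-monoʳ-≤ ℓ bound ⟩
  ℓ * (branches ℓ (ℓ + ℓ) * m)         ≡⟨ *-assoc ℓ (branches ℓ (ℓ + ℓ)) m ⟨
  ℓ * branches ℓ (ℓ + ℓ) * m           ≤⟨ *-monoˡ-≤ m (≤-trans (m≤n+m _ (ℓ + ℓ)) (m≤n+m _ n)) ⟩
  (n + slack ℓ) * m                    ∎
  where open ≤-Reasoning

-- Induction over the differences in decreasing order.

module Descending = Sort (Flip.decTotalOrder ≤-decTotalOrder)

Decreasing : List ℕ → Set
Decreasing = AllPairs _>_

sort-decreasing : ∀ {L} → Unique L → Decreasing (Descending.sort L)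
sort-decreasing {L} L! = AllPairs.zipWith (λ (y≤x , x≢y) → ≤∧≢⇒< y≤x (x≢y ∘ sym))
  ( Sorted⇒AllPairs (Flip.totalOrder ≤-totalOrder) (Descending.sort-↗ L)
  , ↭ₛ.Unique-resp-↭ (setoid ℕ) (↭⇒↭ₛ (↭-sym (Descending.sort-↭ L))) L! )

-- `reduction` strips the head `ℓ`, since a subfamily with all differences below `ℓ` is differencing
-- for the tail. With no differences left, at most one member remains.
product-*-length≤ : ∀ {n L} → Decreasing L → All (1 ≤_) L → (F : List (Subset n)) → Unique F → Differencing L F →
                    product L * length F ≤ product (map (λ l → n + slack l) L)
product-*-length≤ [] [] []          _ _ = z≤n
product-*-length≤ [] [] (_ ∷ [])    _ _ = ≤-refl
product-*-length≤ [] [] (_ ∷ _ ∷ _) ((A≢B ∷ _) ∷ _) diff with () ← diff (here refl) (there (here refl)) A≢B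
product-*-length≤ {n} {ℓ ∷ L} (ℓ> ∷ L>) (0<ℓ ∷ L≥1) F F! diff =
  ≤-trans (≤-reflexive (*-assoc ℓ (product L) (length F))) (reduction {w = product L} 0<ℓ ≤ℓ small)
  where
  ≤ℓ : ∀ {A B} → A List.∈ F → B List.∈ F → ∣ A ─ B ∣ ≤ ℓ
  ≤ℓ {A} {B} A∈ B∈ with ≡-dec Bool._≟_ A B
  ... | yes refl = ≤-trans (≤-reflexive (∣p─p∣≡0 A)) z≤n
  ... | no A≢B   = All.lookup (≤-refl ∷ All.map <⇒≤ ℓ>) (diff A∈ B∈ A≢B)
  small : ∀ {H} → H ⊆ F → (∀ {A B} → A List.∈ H → B List.∈ H → ∣ A ─ B ∣ < ℓ) →
          product L * length H ≤ product (map (λ l → n + slack l) L)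
  small {H} H⊆F <ℓ = product-*-length≤ L> L≥1 H (AllPairs-resp-⊆ H⊆F F!) diff′
    where
    diff′ : Differencing L H
    diff′ A∈ B∈ A≢B with diff (Any-resp-⊆ H⊆F A∈) (Any-resp-⊆ H⊆F B∈) A≢B
    ... | here ≡ℓ  = contradiction ≡ℓ (<⇒≢ (<ℓ A∈ B∈))
    ... | there ∈L = ∈L

-- Bounds on the product of the differences.

product≤^ : ∀ {k} xs → All (_≤ k) xs → product xs ≤ k ^ length xs
product≤^ []       []         = ≤-refl
product≤^ (x ∷ xs) (≤k ∷ ≤ks) = *-mono-≤ ≤k (product≤^ xs ≤ks)

length<head : ∀ {l L} → Decreasing (l ∷ L) → All (1 ≤_) (l ∷ L) → length L < l
length<head {L = []}    _                    (1≤l ∷ _) = 1≤l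
length<head {L = _ ∷ _} ((l>l′ ∷ _) ∷ L>) (_ ∷ L≥1) = <-≤-trans (s≤s (length<head L> L≥1)) l>l′

length!≤product : ∀ {L} → Decreasing L → All (1 ≤_) L → length L ! ≤ product L
length!≤product []            []                = ≤-refl
length!≤product L>@(_ ∷ L′>) L≥1@(_ ∷ L′≥1) = *-mono-≤ (length<head L> L≥1) (length!≤product L′> L′≥1)

-- A head this small leaves no room for gaps, and the tail inherits the equality.
head≡length⇒countdown : ∀ {l L} → Decreasing (l ∷ L) → All (1 ≤_) (l ∷ L) → l ≡ suc (length L) →
                        l ∷ L ≡ map suc (downFrom (suc (length L)))
head≡length⇒countdown {L = []}    _ _ refl = refl
head≡length⇒countdown {L = _ ∷ L} ((l>l′ ∷ _) ∷ L>) (_ ∷ L≥1) refl =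
  cong (2 + length L ∷_) (head≡length⇒countdown L> L≥1 (≤-antisym (s≤s⁻¹ l>l′) (length<head L> L≥1)))

-- With `s` entries, a head other than `s` is at least `s + 1`, while the tail has product at least
-- `(s - 1)!`.
countdown⊎product : ∀ {L} → Decreasing L → All (1 ≤_) L →
                    L ≡ map suc (downFrom (length L)) ⊎ suc (length L) ! ≤ length L * product L
countdown⊎product {[]}    _ _ = inj₁ refl
countdown⊎product {l ∷ L} L> L≥1 with m≤n⇒m<n∨m≡n (length<head L> L≥1)
... | inj₂ eq = inj₁ (head≡length⇒countdown L> L≥1 (sym eq))
... | inj₁ s<l = inj₂ (begin
  suc s * (s * length L !)  ≡⟨ *-x∙yz≈y∙xz (suc s) s (length L !) ⟩
  s * (suc s * length L !)  ≤⟨ *-monoʳ-≤ s (*-mono-≤ s<l (length!≤product (AllPairs.tail L>) (All.tail L≥1))) ⟩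
  s * (l * product L)       ∎)
  where
  open ≤-Reasoning
  s = suc (length L)

↭countdown⇒∼[1⋯] : ∀ {L s} → map suc (downFrom s) ↭ L → L ∼[ set ] [1⋯ s ]
↭countdown⇒∼[1⋯] {L} {s} ↭L = bag-=⇒ (↭⇒∼bag (↭-trans (↭-sym ↭L)
  (↭.map⁺ suc (↭-trans (↭-reflexive (sym (reverse-upTo s))) (↭-reverse (upTo s))))))

-- Comparison with the binomial coefficient.

[n∸k]^k≤nP′k : ∀ n k → (n ∸ k) ^ k ≤ n P′ k
[n∸k]^k≤nP′k n zero    = ≤-refl
[n∸k]^k≤nP′k n (suc k) = *-mono-≤ n∸1+k≤n∸k (≤-trans (^-monoˡ-≤ k n∸1+k≤n∸k) ([n∸k]^k≤nP′k n k))
  where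
  n∸1+k≤n∸k : n ∸ suc k ≤ n ∸ k
  n∸1+k≤n∸k = ∸-monoʳ-≤ n (n≤1+n k)

nCk*k!≡nP′k : ∀ {n k} → k ≤ n → (n C k) * k ! ≡ n P′ k
nCk*k!≡nP′k {n} {k} k≤n = begin
  (n C k) * k !          ≡⟨ cong (_* k !) (nCk≡nPk/k! k≤n) ⟩
  (n P k) / k ! * k !    ≡⟨ cong (λ m → m / k ! * k !) (trans (nPk≡n!/[n∸k]! k≤n) (sym (nP′k≡n!/[n∸k]! k≤n))) ⟩
  (n P′ k) / k ! * k !   ≡⟨ m/n*n≡m (k!∣nP′k k≤n) ⟩
  n P′ k                 ∎
  where
  open ≡-Reasoning
  instance _ = k !≢0

-- Each factor (m + d) / m costs at most one step of the telescoping product j, j + 1, …, j + t.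
j*[m+d]^t≤[j+t]*m^t : ∀ t j {m d} → (j + t) * d ≤ m → j * (m + d) ^ t ≤ (j + t) * m ^ t
j*[m+d]^t≤[j+t]*m^t zero    j         _ = ≤-reflexive (cong (_* 1) (sym (+-identityʳ j)))
j*[m+d]^t≤[j+t]*m^t (suc t) j {m} {d} le = begin
  j * ((m + d) * (m + d) ^ t)    ≡⟨ *-assoc j (m + d) _ ⟨
  j * (m + d) * (m + d) ^ t      ≤⟨ *-monoˡ-≤ ((m + d) ^ t) step ⟩
  suc j * m * (m + d) ^ t        ≡⟨ *-xy∙z≈y∙xz (suc j) m _ ⟩
  m * (suc j * (m + d) ^ t)      ≤⟨ *-monoʳ-≤ m (j*[m+d]^t≤[j+t]*m^t t (suc j) (subst (λ k → k * d ≤ m) (+-suc j t) le)) ⟩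
  m * ((suc j + t) * m ^ t)      ≡⟨ *-x∙yz≈y∙xz m (suc j + t) (m ^ t) ⟩
  (suc j + t) * (m * m ^ t)      ≡⟨ cong (_* (m * m ^ t)) (+-suc j t) ⟨
  (j + suc t) * (m * m ^ t)      ∎
  where
  open ≤-Reasoning
  step : j * (m + d) ≤ suc j * m
  step = begin
    j * (m + d)     ≡⟨ *-distribˡ-+ j m d ⟩
    j * m + j * d   ≤⟨ +-monoʳ-≤ (j * m) (≤-trans (*-monoˡ-≤ d (m≤m+n j (suc t))) le) ⟩
    j * m + m       ≡⟨ +-comm (j * m) m ⟩
    suc j * m       ∎

-- This is the desired bound for ε = p / r with denominators cleared. After multiplication by `s !`,
-- both sides are compared with powers of `n ∸ s`.
asymptotic : ∀ s {c p r f w n} → 1 ≤ p → s ≤ n → (s * r + s) * (s + c) ≤ n ∸ s →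
             w * f ≤ (n + c) ^ s → suc s ! ≤ s * w →
             f * (suc s * r) ≤ (s * r + p * suc s) * (n C s)
asymptotic s {c} {p} {r} {f} {w} {n} 1≤p s≤n large wf≤ s!≤ =
  *-cancelʳ-≤ _ _ (s !) {{s !≢0}} (begin
    f * (suc s * r) * s !                  ≡⟨ lemma₁ f (suc s) r (s !) ⟩
    suc s ! * (f * r)                      ≤⟨ *-monoˡ-≤ (f * r) s!≤ ⟩
    s * w * (f * r)                        ≡⟨ lemma₂ s w f r ⟩
    s * r * (w * f)                        ≤⟨ *-monoʳ-≤ (s * r) wf≤ ⟩
    s * r * (n + c) ^ s                    ≡⟨ cong (λ k → s * r * k ^ s) n+c≡ ⟩
    -- Starting the telescoping at `s * r` makes the total loss `s`, which the ε-term `p * suc s`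
    -- absorbs.
    s * r * (n ∸ s + (s + c)) ^ s          ≤⟨ j*[m+d]^t≤[j+t]*m^t s (s * r) large ⟩
    (s * r + s) * (n ∸ s) ^ s              ≤⟨ *-mono-≤ (+-monoʳ-≤ (s * r) s≤p[1+s])
                                                (≤-trans ([n∸k]^k≤nP′k n s) (≤-reflexive (sym (nCk*k!≡nP′k s≤n)))) ⟩
    (s * r + p * suc s) * ((n C s) * s !)  ≡⟨ *-assoc (s * r + p * suc s) (n C s) (s !) ⟨
    (s * r + p * suc s) * (n C s) * s !    ∎)
  where
  open ≤-Reasoning
  lemma₁ : ∀ x y z u → x * (y * z) * u ≡ y * u * (x * z)
  lemma₁ = solve-∀
  lemma₂ : ∀ x y z u → x * y * (z * u) ≡ x * u * (y * z)
  lemma₂ = solve-∀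
  n+c≡ : n + c ≡ n ∸ s + (s + c)
  n+c≡ = trans (cong (_+ c) (sym (m∸n+n≡m s≤n))) (+-assoc (n ∸ s) s c)
  s≤p[1+s] : s ≤ p * suc s
  s≤p[1+s] = ≤-trans (n≤1+n s) (m≤n*m (suc s) p {{>-nonZero 1≤p}})

-- Passage to rationals and conclusion.

-- For unnormalised rationals the claim is a cross-multiplied integer inequality; the normalised
-- operations agree with them up to equivalence.
fromℕ-≤ : ∀ f c s p r-1 .(cop : Coprime p (suc r-1)) → f * (suc s * suc r-1) ≤ (s * suc r-1 + p * suc s) * c →
          fromℕ f ℚ.≤ ((ℤ.+ s ℚ./ suc s) ℚ.+ mkℚ (ℤ.+ p) r-1 cop) ℚ.* fromℕ c
fromℕ-≤ f c s p r-1 cop le = toℚᵘ-cancel-≤ (begin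
  ℚ.toℚᵘ (fromℕ f)                                  ≃⟨ toℚᵘ-fromℚᵘ (mkℚᵘ (ℤ.+ f) 0) ⟩
  mkℚᵘ (ℤ.+ f) 0                                      ≤⟨ *≤* (subst₂ ℤ._≤_ numerator₁ numerator₂ (+≤+ le)) ⟩
  (mkℚᵘ (ℤ.+ s) s ℚᵘ.+ ℚ.toℚᵘ ε) ℚᵘ.* mkℚᵘ (ℤ.+ c) 0
                                                    ≃⟨ ℚᵘ.*-cong (ℚᵘ.+-congˡ (ℚ.toℚᵘ ε) (toℚᵘ-fromℚᵘ (mkℚᵘ (ℤ.+ s) s))) (toℚᵘ-fromℚᵘ (mkℚᵘ (ℤ.+ c) 0)) ⟨
  (ℚ.toℚᵘ (ℤ.+ s ℚ./ suc s) ℚᵘ.+ ℚ.toℚᵘ ε) ℚᵘ.* ℚ.toℚᵘ (fromℕ c)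
                                                    ≃⟨ ℚᵘ.*-congʳ (toℚᵘ-homo-+ (ℤ.+ s ℚ./ suc s) ε) ⟨
  ℚ.toℚᵘ ((ℤ.+ s ℚ./ suc s) ℚ.+ ε) ℚᵘ.* ℚ.toℚᵘ (fromℕ c)
                                                    ≃⟨ toℚᵘ-homo-* ((ℤ.+ s ℚ./ suc s) ℚ.+ ε) (fromℕ c) ⟨
  ℚ.toℚᵘ (((ℤ.+ s ℚ./ suc s) ℚ.+ ε) ℚ.* fromℕ c)    ∎)
  where
  open ℚᵘ.≤-Reasoning
  ε = mkℚ (ℤ.+ p) r-1 cop
  numerator₁ : ℤ.+ (f * (suc s * suc r-1)) ≡ ℤ.+ f ℤ.* ℤ.+ (suc s * suc r-1 * 1)
  numerator₁ = trans (cong (λ k → ℤ.+ (f * k)) (sym (*-identityʳ (suc s * suc r-1)))) (ℤ.pos-* f _)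
  numerator₂ : ℤ.+ ((s * suc r-1 + p * suc s) * c) ≡ (ℤ.+ s ℤ.* ℤ.+ suc r-1 ℤ.+ ℤ.+ p ℤ.* ℤ.+ suc s) ℤ.* ℤ.+ c ℤ.* ℤ.+ 1
  numerator₂ = sym (trans (ℤ.*-identityʳ _) (trans
    (cong₂ (λ i j → (i ℤ.+ j) ℤ.* ℤ.+ c) (sym (ℤ.pos-* s (suc r-1))) (sym (ℤ.pos-* p (suc s))))
    (sym (ℤ.pos-* (s * suc r-1 + p * suc s) c))))

theorem1p2 : ∀ (s : ℕ) → 1 ≤ s →
    ∀ (L : List ℕ) → Unique L → length L ≡ s → All (1 ≤_) L →
    ¬ (L ∼[ set ] [1⋯ s ]) →
    ∀ (ε : ℚ) → 0ℚ ℚ.< ε →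
    ∃[ n₀ ] ∀ (n : ℕ) → n ≥ n₀ →
    ∀ (F : List (Subset n)) → Unique F → Differencing L F →
    fromℕ (length F) ℚ.≤ ((ℤ.+ s ℚ./ suc s) ℚ.+ ε) ℚ.* fromℕ (n C s)
theorem1p2 s _ L L! refl L≥1 L≢[1⋯s] (mkℚ (ℤ.+ 0)      _ _)      (*<* (+<+ ()))
theorem1p2 s _ L L! refl L≥1 L≢[1⋯s] (mkℚ +[1+ p ] r-1 cop) _ = n₀ , bound
  where
  L′ = Descending.sort L
  L′↭L : L′ ↭ L
  L′↭L = Descending.sort-↭ L
  L′≥1 : All (1 ≤_) L′
  L′≥1 = All-resp-↭ (↭-sym L′↭L) L≥1
  -- A single constant, depending on L alone, that dominates every slack.
  c = max 0 (map slack L′)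
  gap = (s * suc r-1 + s) * (s + c)
  -- This gives both `s ≤ n` and `gap ≤ n ∸ s`, the two size conditions of `asymptotic`.
  n₀ = gap + s

  [1+s]!≤ : suc s ! ≤ s * product L′
  [1+s]!≤ with countdown⊎product (sort-decreasing L!) L′≥1
  ... | inj₂ le = subst (λ k → suc k ! ≤ k * product L′) (↭-length L′↭L) le
  ... | inj₁ eq = ⊥-elim (L≢[1⋯s]
    (↭countdown⇒∼[1⋯] (↭-trans (↭-reflexive (trans (cong (map suc ∘ downFrom) (sym (↭-length L′↭L))) (sym eq))) L′↭L)))

  bound : ∀ n → n ≥ n₀ → (F : List (Subset n)) → Unique F → Differencing L F → _
  bound n n≥n₀ F F! diff = fromℕ-≤ (length F) (n C s) s (suc p) r-1 cop
    (asymptotic s {c = c} {p = suc p} (s≤s z≤n) (≤-trans (m≤n+m s gap) n≥n₀)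
      (≤-trans (≤-reflexive (sym (m+n∸n≡m gap s))) (∸-monoˡ-≤ s n≥n₀)) (begin
        product L′ * length F
          ≤⟨ product-*-length≤ (sort-decreasing L!) L′≥1 F F! (λ A∈ B∈ A≢B → Any-resp-↭ (↭-sym L′↭L) (diff A∈ B∈ A≢B)) ⟩
        product (map (λ l → n + slack l) L′)
          ≤⟨ product≤^ _ (All.map⁺ (All.map (+-monoʳ-≤ n) (All.map⁻ (xs≤max 0 (map slack L′))))) ⟩
        (n + c) ^ length (map (λ l → n + slack l) L′)
          ≡⟨ cong ((n + c) ^_) (trans (length-map _ L′) (↭-length L′↭L)) ⟩
        (n + c) ^ s
          ∎) [1+s]!≤)
    where open ≤-Reasoning
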